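{- Let $f$ be a cover. Then a Galois closure of $f$ exists and is unique up to isomorphism. Moreover, for a cover $g$ the following are equivalent: (i) $g$ is a Galois closure of $f$; (ii) $g$ is a least cover with respect to the property that $g$ is Galois and $f\sqsubseteq g$; (iii) $g$ is a least cover with respect to the property $|{\rm Hom}(g,f)|=\deg f$; (iv) $g$ is a minimal cover with respect to the property $|{\rm Hom}(g,f)|=\deg f$.
   Context: Let $\mathbf C$ be a category and $\mathbf D$ a full subcategory of $\mathbf C$. For arrows $f,g$ of $\mathbf C$ with ${\rm cod}\,f={\rm cod}\,g$, ${\rm Hom}(g,f)$ denotes the collection of all arrows $h$ of $\mathbf C$ with $g=f\circ h$. Standing assumptions: (G1) every diagram $B\to A\leftarrow C$ in $\mathbf D$ has a pullback in $\mathbf C$. (G2) (I) pushouts exist in $\mathbf D$; (II) every arrow of $\mathbf D$ is epic; (III) every monic arrow of $\mathbf D$ is an isomorphism whose inverse is an arrow of $\mathbf D$. (G3) for every object $U$ of $\mathbf C$ there is a set $\Sigma(U)$ of arrows $i$ of $\mathbf C$ with ${\rm dom}\,i$ in $\mathbf D$ and ${\rm cod}\,i=U$ such that for every arrow $u$ of $\mathbf C$ with ${\rm dom}\,u$ in $\mathbf D$ and ${\rm cod}\,u=U$ there is exactly one $i\in\Sigma(U)$ with ${\rm Hom}(u,i)\neq\emptyset$. (G4) there is a function $\deg$ from the collection of arrows of $\mathbf C$ whose codomain lies in $\mathbf D$ to the positive integers such that (I) $\deg(g\circ f)=\deg g\cdot\deg f$ whenever $f,g,g\circ f$ all lie in this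 collection; (II) $\deg f=\sum_{i\in\Sigma({\rm dom}\,f)}\deg(f\circ i)$ for every such $f$; (III) if $B\xrightarrow{f}A\xleftarrow{g}C$ is a diagram in $\mathbf D$ with pullback $B\xleftarrow{p}U\xrightarrow{q}C$, then $\deg f=\deg q$ and $\deg g=\deg p$. A cover is an arrow of $\mathbf D$. For a cover $f$, ${\rm Aut}(f)$ is the set of isomorphisms in ${\rm Hom}(f,f)$; $f$ is Galois if $|{\rm Aut}(f)|=\deg f$. Write $f\sqsubseteq g$ if ${\rm cod}\,f={\rm cod}\,g$ and ${\rm Hom}(g,f)\neq\emptyset$. Two covers $f,g$ are isomorphic if $f\sqsubseteq g$ and $g\sqsubseteq f$. A cover $g$ is least with respect to a property $P$ if $g$ has $P$ and $g\sqsubseteq h$ for every cover $h$ with $P$; it is minimal with respect to $P$ if $g$ has $P$ and $g\sqsubseteq h$ for every cover $h$ with $P$ and $h\sqsubseteq g$. A Galois closure of a cover $f$ is a cover $g$ which is minimal with respect to the property "$g$ is Galois and $f\sqsubseteq g$". -}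

module Defs where

open import Level using (Level; _⊔_; suc)
open import Data.Nat using (ℕ; zero; _+_; _*_; _≤_) renaming (suc to sucℕ)
open import Data.Fin using (Fin) renaming (zero to fz; suc to fs)
open import Data.Product using (Σ; Σ-syntax; ∃; ∃-syntax; _×_; _,_; proj₁; proj₂)
open import Function.Bundles using (_↔_; Inverse; _⇔_)
open import Function.Definitions using (Injective)
open import Relation.Binary.PropositionalEquality using (_≡_)

finSum : (n : ℕ) → (Fin n → ℕ) → ℕ
finSum zero    a = 0
finSum (sucℕ n) a = a fz + finSum n (λ k → a (fs k))

-- A category C with arrows compared by propositional equality, a full
-- subcategory D given by a predicate on objects, and the structure
-- (G1)-(G4) of the paper.
record GaloisCat (o ℓ : Level) : Set (suc (o ⊔ ℓ)) where
  infixr 9 _∘_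
  field
    Obj  : Set o
    Hom  : Obj → Obj → Set ℓ
    id   : ∀ {A} → Hom A A
    _∘_  : ∀ {A B C} → Hom B C → Hom A B → Hom A C
    assoc     : ∀ {A B C D} (f : Hom A B) (g : Hom B C) (h : Hom C D) →
                (h ∘ g) ∘ f ≡ h ∘ (g ∘ f)
    identityˡ : ∀ {A B} (f : Hom A B) → id ∘ f ≡ f
    identityʳ : ∀ {A B} (f : Hom A B) → f ∘ id ≡ f
    inD  : Obj → Set ℓ

  IsPullback : ∀ {A B C U} → Hom B A → Hom C A → Hom U B → Hom U C → Set (o ⊔ ℓ)
  IsPullback {A} {B} {C} {U} f g p q =
    (f ∘ p ≡ g ∘ q) ×
    (∀ {W} (p' : Hom W B) (q' : Hom W C) → f ∘ p' ≡ g ∘ q' →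
      Σ[ u ∈ Hom W U ] ((p ∘ u ≡ p') × (q ∘ u ≡ q') ×
        (∀ (u' : Hom W U) → p ∘ u' ≡ p' → q ∘ u' ≡ q' → u' ≡ u)))

  IsPushoutD : ∀ {A B C P} → Hom A B → Hom A C → Hom B P → Hom C P → Set (o ⊔ ℓ)
  IsPushoutD {A} {B} {C} {P} f g i j =
    inD P × (i ∘ f ≡ j ∘ g) ×
    (∀ {W} → inD W → (x : Hom B W) (y : Hom C W) → x ∘ f ≡ y ∘ g →
      Σ[ u ∈ Hom P W ] ((u ∘ i ≡ x) × (u ∘ j ≡ y) ×
        (∀ (u' : Hom P W) → u' ∘ i ≡ x → u' ∘ j ≡ y → u' ≡ u)))

  HomNE : ∀ {V S U} → Hom V U → Hom S U → Set ℓ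
  HomNE {V} {S} u i = Σ[ h ∈ Hom V S ] (i ∘ h ≡ u)

  IsIso : ∀ {A B} → Hom A B → Set ℓ
  IsIso {A} {B} h = Σ[ k ∈ Hom B A ] ((k ∘ h ≡ id) × (h ∘ k ≡ id))

  field
    pullback : ∀ {A B C} → inD A → inD B → inD C → (f : Hom B A) (g : Hom C A) →
               Σ[ U ∈ Obj ] Σ[ p ∈ Hom U B ] Σ[ q ∈ Hom U C ] IsPullback f g p q
    pushout  : ∀ {A B C} → inD A → inD B → inD C → (f : Hom A B) (g : Hom A C) →
               Σ[ P ∈ Obj ] Σ[ i ∈ Hom B P ] Σ[ j ∈ Hom C P ] IsPushoutD f g i j
    epic     : ∀ {A B W} → inD A → inD B → inD W → (h : Hom A B) (x y : Hom B W) →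
               x ∘ h ≡ y ∘ h → x ≡ y
    monicIso : ∀ {A B} → inD A → inD B → (h : Hom A B) →
               (∀ {W} → inD W → (x y : Hom W A) → h ∘ x ≡ h ∘ y → x ≡ y) →
               IsIso h
    -- (G3) the sets Σ(U), given as index families
    SigIdx   : Obj → Set ℓ
    sigDom   : ∀ {U} → SigIdx U → Obj
    sigDomD  : ∀ {U} (i : SigIdx U) → inD (sigDom i)
    sigArr   : ∀ {U} (i : SigIdx U) → Hom (sigDom i) U
    sigUnique : ∀ {U V} → inD V → (u : Hom V U) →
               Σ[ i ∈ SigIdx U ] (HomNE u (sigArr i) ×
                 (∀ (j : SigIdx U) → HomNE u (sigArr j) → j ≡ i))
    -- (G4) degree (only its values on arrows with codomain in D matter)
    deg      : ∀ {A B} → Hom A B → ℕ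
    degPos   : ∀ {A B} → inD B → (f : Hom A B) → 1 ≤ deg f
    degMul   : ∀ {A B C} → inD B → inD C → (f : Hom A B) (g : Hom B C) →
               deg (g ∘ f) ≡ deg g * deg f
    degSum   : ∀ {U B} → inD B → (f : Hom U B) →
               Σ[ n ∈ ℕ ] Σ[ e ∈ (Fin n ↔ SigIdx U) ]
                 (deg f ≡ finSum n (λ k → deg (f ∘ sigArr (Inverse.to e k))))
    degPullback : ∀ {A B C U} → inD A → inD B → inD C →
               (f : Hom B A) (g : Hom C A) (p : Hom U B) (q : Hom U C) →
               IsPullback f g p q → (deg f ≡ deg q) × (deg g ≡ deg p)

module _ {o ℓ : Level} (𝒢 : GaloisCat o ℓ) where
  open GaloisCat 𝒢

  record Cover (X : Obj) : Set (o ⊔ ℓ) where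
    constructor cover
    field
      dom  : Obj
      domD : inD dom
      arr  : Hom dom X
  open Cover public

  HasCard : ∀ {A B} → ℕ → (Hom A B → Set ℓ) → Set ℓ
  HasCard {A} {B} n P =
    Σ[ e ∈ (Fin n → Hom A B) ] ((∀ k → P (e k)) × Injective _≡_ _≡_ e ×
      (∀ h → P h → Σ[ k ∈ Fin n ] (e k ≡ h)))

  HomC : ∀ {X} → (g f : Cover X) → Hom (dom g) (dom f) → Set ℓ
  HomC g f h = arr f ∘ h ≡ arr g

  _⊑_ : ∀ {X} → Cover X → Cover X → Set ℓ
  f ⊑ g = Σ[ h ∈ Hom (dom g) (dom f) ] HomC g f h

  CoverIso : ∀ {X} → Cover X → Cover X → Set ℓ
  CoverIso f g = (f ⊑ g) × (g ⊑ f)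

  Aut : ∀ {X} → (f : Cover X) → Hom (dom f) (dom f) → Set ℓ
  Aut f h = HomC f f h × IsIso h

  IsGalois : ∀ {X} → Cover X → Set ℓ
  IsGalois f = HasCard (deg (arr f)) (Aut f)

  Least : ∀ {X} → (Cover X → Set ℓ) → Cover X → Set (o ⊔ ℓ)
  Least P g = P g × (∀ h → P h → g ⊑ h)

  Minimal : ∀ {X} → (Cover X → Set ℓ) → Cover X → Set (o ⊔ ℓ)
  Minimal P g = P g × (∀ h → P h → h ⊑ g → g ⊑ h)

  GaloisOver : ∀ {X} → Cover X → Cover X → Set ℓ
  GaloisOver f g = IsGalois g × (f ⊑ g)

  FullHom : ∀ {X} → Cover X → Cover X → Set ℓ
  FullHom f g = HasCard (deg (arr f)) (HomC g f)

  IsGaloisClosure : ∀ {X} → Cover X → Cover X → Set (o ⊔ ℓ)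
  IsGaloisClosure f g = Minimal (GaloisOver f) g

{-# OPTIONS --safe #-}
-- Call g full for f (Lifting f g) when every lift of g ∘ w through f, for any
-- arrow w of D, comes from a lift of g.  Splitting the pullback U of f and g into
-- the components Σ(U) identifies Hom(g, f) with the components of degree 1 over
-- dom g, so fullness is the same as |Hom(g, f)| = deg f.
-- A least full cover is obtained constructively, without minimising a degree:
-- start from g = id and repeatedly replace g by its composite with a component of
-- degree > 1 of the pullback of f and g.  Each such step enlarges Hom(g, f), whose
-- size is at most deg f, and keeps g below every full cover.
-- If g is least full, then two lifts w, h of g ∘ w through g have a pushout that is
-- again full, hence of the same degree over X as g; this yields an automorphism
-- carrying w to h, so g is Galois.  Conversely a Galois cover above f is full for f.
module Submission where

open import Defs
open import Level using (Level; _⊔_)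
open import Data.Nat using (ℕ; zero; suc; _+_; _*_; _≤_; z≤n; s≤s; _≟_; >-nonZero)
open import Data.Nat.Properties
  using (≤-trans; ≤-reflexive; +-mono-≤; +-suc; +-identityʳ; 1+n≰n; *-assoc;
         *-identityʳ; *-cancelˡ-≡; m*n≡1⇒m≡1; m*n≡1⇒n≡1)
open import Data.Fin using (Fin; zero; suc)
import Data.Fin.Properties as Fin
open import Data.Product using (Σ; Σ-syntax; ∃-syntax; _×_; _,_; proj₁; proj₂)
open import Data.Vec.Functional using (_∷_)
open import Function.Bundles using (_⇔_; Equivalence; Inverse; mk⇔)
open import Function.Definitions using (Injective)
open import Relation.Binary.PropositionalEquality
  using (_≡_; _≢_; refl; sym; trans; cong; subst; module ≡-Reasoning)
open import Relation.Nullary using (Dec; yes; no; ¬?; contradiction)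
open import Relation.Nullary.Decidable using (decidable-stable; map′)

open ≡-Reasoning

-- Finite sums of natural numbers.

n≤finSum : ∀ n (a : Fin n → ℕ) → (∀ k → 1 ≤ a k) → n ≤ finSum n a
n≤finSum zero    a a≥1 = z≤n
n≤finSum (suc n) a a≥1 = +-mono-≤ (a≥1 zero) (n≤finSum n _ (λ k → a≥1 (suc k)))

finSum-ones : ∀ n (a : Fin n → ℕ) → (∀ k → a k ≡ 1) → finSum n a ≡ n
finSum-ones zero    a a≡1 = refl
finSum-ones (suc n) a a≡1 rewrite a≡1 zero = cong suc (finSum-ones n _ (λ k → a≡1 (suc k)))

finSum-inhabited : ∀ n (a : Fin n → ℕ) → 1 ≤ finSum n a → Fin n
finSum-inhabited (suc n) a _ = zero

Fin-irrelevant : ∀ {n} → n ≤ 1 → (j k : Fin n) → j ≡ k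
Fin-irrelevant (s≤s z≤n) zero zero = refl

m*n≡m⇒n≡1 : ∀ {m n} → 1 ≤ m → m * n ≡ m → n ≡ 1
m*n≡m⇒n≡1 {m} {n} m≥1 eq =
  *-cancelˡ-≡ n 1 m {{>-nonZero m≥1}} (trans eq (sym (*-identityʳ m)))

module _ {o ℓ : Level} (𝒢 : GaloisCat o ℓ) where
  open GaloisCat 𝒢

  infixl 20 _⟩∘_
  infixr 21 _∘⟨_
  _⟩∘_ : ∀ {A B C} {f g : Hom B C} → f ≡ g → (h : Hom A B) → f ∘ h ≡ g ∘ h
  eq ⟩∘ h = cong (_∘ h) eq

  _∘⟨_ : ∀ {A B C} {g h : Hom A B} (f : Hom B C) → g ≡ h → f ∘ g ≡ f ∘ h
  f ∘⟨ eq = cong (f ∘_) eq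

  pullˡ : ∀ {A B C D} {f : Hom A B} {g : Hom B C} {h : Hom C D} {k : Hom B D} →
          h ∘ g ≡ k → h ∘ (g ∘ f) ≡ k ∘ f
  pullˡ {f = f} {g} {h} eq = trans (sym (assoc f g h)) (eq ⟩∘ f)

  pullʳ : ∀ {A B C D} {f : Hom A B} {g : Hom B C} {h : Hom C D} {k : Hom A C} →
          g ∘ f ≡ k → (h ∘ g) ∘ f ≡ h ∘ k
  pullʳ {f = f} {g} {h} eq = trans (assoc f g h) (h ∘⟨ eq)

  -- Degrees of sections and components of pullbacks.

  deg-id : ∀ {A} → inD A → deg (id {A}) ≡ 1
  deg-id A∈ = m*n≡m⇒n≡1 (degPos A∈ id)
    (trans (sym (degMul A∈ A∈ id id)) (cong deg (identityˡ id)))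

  section⇒deg≡1 : ∀ {A B} → inD A → inD B → {f : Hom B A} {s : Hom A B} →
                  f ∘ s ≡ id → deg f ≡ 1
  section⇒deg≡1 A∈ B∈ {f} {s} fs = m*n≡1⇒m≡1 (deg f) (deg s)
    (trans (sym (degMul B∈ A∈ s f)) (trans (cong deg fs) (deg-id A∈)))

  -- The decomposition of the pullback of f and g into its components Σ(U).
  record Components {A B C} (f : Hom B A) (g : Hom C A) : Set (o ⊔ ℓ) where
    field
      size   : ℕ
      obj    : Fin size → Obj
      objD   : ∀ k → inD (obj k)
      p      : ∀ k → Hom (obj k) B
      q      : ∀ k → Hom (obj k) C
      comm   : ∀ k → f ∘ p k ≡ g ∘ q k
      degree : deg f ≡ finSum size (λ k → deg (q k))
      factor : ∀ {W} → inD W → (x : Hom W B) (y : Hom W C) → f ∘ x ≡ g ∘ y →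
               ∃[ k ] Σ[ t ∈ Hom W (obj k) ] (p k ∘ t ≡ x × q k ∘ t ≡ y)
      unique : ∀ {W} → inD W → ∀ {j k} (s : Hom W (obj j)) (t : Hom W (obj k)) →
               p j ∘ s ≡ p k ∘ t → q j ∘ s ≡ q k ∘ t → j ≡ k

  components : ∀ {A B C} → inD A → inD B → inD C →
               (f : Hom B A) (g : Hom C A) → Components f g
  components A∈ B∈ C∈ f g
    with U , p , q , pb@(square , universal) ← pullback A∈ B∈ C∈ f g
    with n , e , sum ← degSum C∈ q = record
      { size   = n
      ; obj    = λ k → sigDom (to k)
      ; objD   = λ k → sigDomD (to k)
      ; p      = λ k → p ∘ sigArr (to k)
      ; q      = λ k → q ∘ sigArr (to k)
      ; comm   = λ k → trans (pullˡ square) (assoc _ _ _)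
      ; degree = trans (proj₁ (degPullback A∈ B∈ C∈ f g p q pb)) sum
      ; factor = factor
      ; unique = unique
      }
    where
    open Inverse e using (to; from; strictlyInverseˡ; strictlyInverseʳ)

    factor : ∀ {W} → inD W → (x : Hom W _) (y : Hom W _) → f ∘ x ≡ g ∘ y →
             ∃[ k ] Σ[ t ∈ Hom W (sigDom (to k)) ]
               ((p ∘ sigArr (to k)) ∘ t ≡ x × (q ∘ sigArr (to k)) ∘ t ≡ y)
    factor W∈ x y eq
      with u , pu , qu , _ ← universal x y eq
      with i , ne , _ ← sigUnique W∈ u
      with t , it ← subst (λ i → HomNE u (sigArr i)) (sym (strictlyInverseˡ i)) ne
      = from i , t , trans (pullʳ it) pu , trans (pullʳ it) qu

    unique : ∀ {W} → inD W → ∀ {j k} (s : Hom W (sigDom (to j))) (t : Hom W (sigDom (to k))) →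
             (p ∘ sigArr (to j)) ∘ s ≡ (p ∘ sigArr (to k)) ∘ t →
             (q ∘ sigArr (to j)) ∘ s ≡ (q ∘ sigArr (to k)) ∘ t → j ≡ k
    unique W∈ {j} {k} s t ps qs
      -- Both composites into the pullback have the same projections, so they coincide; (G3) then
      -- allows only one index.
      with _ , _ , _ , only ← universal (p ∘ (sigArr (to k) ∘ t)) (q ∘ (sigArr (to k) ∘ t))
                                (trans (pullˡ square) (assoc _ _ _))
      with _ , _ , i-only ← sigUnique W∈ (sigArr (to k) ∘ t)
      = begin
        j           ≡⟨ strictlyInverseʳ j ⟨
        from (to j) ≡⟨ cong from (trans (i-only (to j) (s , same)) (sym (i-only (to k) (t , refl)))) ⟩
        from (to k) ≡⟨ strictlyInverseʳ k ⟩
        k           ∎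
      where
      same : sigArr (to j) ∘ s ≡ sigArr (to k) ∘ t
      same = trans (only _ (trans (sym (assoc _ _ _)) (trans ps (assoc _ _ _)))
                           (trans (sym (assoc _ _ _)) (trans qs (assoc _ _ _))))
                   (sym (only _ refl refl))

  -- Amalgamation and arrows of degree one.

  module _ {A B C} (A∈ : inD A) (B∈ : inD B) (C∈ : inD C) (f : Hom B A) (g : Hom C A) where

    -- Stands in for a pullback inside D: since `deg f` is positive, the sum over components is not
    -- empty, and any component will do.
    amalgamate : Σ[ W ∈ Obj ] inD W × (Σ[ x ∈ Hom W B ] Σ[ y ∈ Hom W C ] f ∘ x ≡ g ∘ y)
    amalgamate = obj k , objD k , p k , q k , comm k
      where
      open Components (components A∈ B∈ C∈ f g)
      k = finSum-inhabited size _ (subst (1 ≤_) degree (degPos A∈ f))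

    size≤deg : (K : Components f g) → Components.size K ≤ deg f
    size≤deg K = subst (size ≤_) (sym degree) (n≤finSum size _ (λ k → degPos C∈ (q k)))
      where open Components K

  -- Over a degree-1 arrow the pullback of h with itself has a single component,
  -- on which the diagonal forces both projections to agree: h is monic.
  deg≡1⇒iso : ∀ {A B} → inD A → inD B → (h : Hom B A) → deg h ≡ 1 → IsIso h
  deg≡1⇒iso A∈ B∈ h deg1 = monicIso B∈ A∈ h monic
    where
    K = components A∈ B∈ B∈ h h
    open Components K

    p≡q : ∀ k → p k ≡ q k
    p≡q k with k₀ , t , pt , qt ← factor B∈ id id refl =
      subst (λ k → p k ≡ q k)
        (Fin-irrelevant (≤-trans (size≤deg A∈ B∈ B∈ h h K) (≤-reflexive deg1)) k₀ k)
        (epic B∈ (objD k₀) B∈ t (p k₀) (q k₀) (trans pt (sym qt)))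

    monic : ∀ {W} → inD W → (x y : Hom W _) → h ∘ x ≡ h ∘ y → x ≡ y
    monic W∈ x y eq with k , t , pt , qt ← factor W∈ x y eq =
      trans (sym pt) (trans (p≡q k ⟩∘ t) qt)

  -- As `g` and `π` factor through each other, comparing degrees over `A` gives `deg c * deg j ≡ 1`.
  retract⇒iso : ∀ {A C P} → inD A → inD P → inD C → (g : Hom C A) (π : Hom P A)
                (c : Hom P C) (j : Hom C P) → g ∘ c ≡ π → π ∘ j ≡ g → IsIso j
  retract⇒iso A∈ P∈ C∈ g π c j gc πj =
    deg≡1⇒iso P∈ C∈ j (m*n≡1⇒n≡1 (deg c) (deg j)
      (m*n≡m⇒n≡1 (degPos A∈ g) (begin
        deg g * (deg c * deg j) ≡⟨ *-assoc (deg g) (deg c) (deg j) ⟨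
        deg g * deg c * deg j   ≡⟨ cong (_* deg j) (degMul C∈ A∈ c g) ⟨
        deg (g ∘ c) * deg j     ≡⟨ cong (λ x → deg x * deg j) gc ⟩
        deg π * deg j           ≡⟨ degMul P∈ A∈ j π ⟨
        deg (π ∘ j)             ≡⟨ cong deg πj ⟩
        deg g                   ∎)))

  factor-iso : ∀ {A C P} {g : Hom C A} {π : Hom P A} {j : Hom C P} {j⁻¹ : Hom P C} →
               π ∘ j ≡ g → j ∘ j⁻¹ ≡ id → g ∘ j⁻¹ ≡ π
  factor-iso {π = π} {j⁻¹ = j⁻¹} πj jj⁻¹ =
    trans (sym (πj ⟩∘ j⁻¹)) (trans (pullʳ jj⁻¹) (identityʳ π))

  section-unique : ∀ {A B} → inD A → inD B → {f : Hom B A} {s t : Hom A B} →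
                   f ∘ s ≡ id → f ∘ t ≡ id → s ≡ t
  section-unique A∈ B∈ {f} {s} {t} fs ft
    with k , kf , _ ← deg≡1⇒iso A∈ B∈ f (section⇒deg≡1 A∈ B∈ fs) = begin
      s           ≡⟨ identityˡ s ⟨
      id ∘ s      ≡⟨ kf ⟩∘ s ⟨
      (k ∘ f) ∘ s ≡⟨ pullʳ (trans fs (sym ft)) ⟩
      k ∘ (f ∘ t) ≡⟨ pullˡ kf ⟩
      id ∘ t      ≡⟨ identityˡ t ⟩
      t           ∎

  -- Lifts and their enumeration by components.

  Lifting : ∀ {A B C} → Hom B A → Hom C A → Set (o ⊔ ℓ)
  Lifting {A} {B} {C} f g = ∀ {W} → inD W → (w : Hom W C) (h : Hom W B) → f ∘ h ≡ g ∘ w →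
    Σ[ h′ ∈ Hom C B ] (f ∘ h′ ≡ g × h′ ∘ w ≡ h)

  module _ {A B C} (A∈ : inD A) (B∈ : inD B) (C∈ : inD C) (f : Hom B A) (g : Hom C A) where
    private
      K = components A∈ B∈ C∈ f g
    open Components K

    -- The graph of `h`, that is the arrow from `C` into the pullback with projections `h` and `id`,
    -- lands in component `k`.
    OnComponent : Hom C B → Fin size → Set ℓ
    OnComponent h k = Σ[ t ∈ Hom C (obj k) ] (p k ∘ t ≡ h × q k ∘ t ≡ id)

    onComponent : ∀ h → f ∘ h ≡ g → ∃[ k ] OnComponent h k
    onComponent h fh = factor C∈ h id (trans fh (sym (identityʳ g)))

    onComponent-functional : ∀ {h j k} → OnComponent h j → OnComponent h k → j ≡ k
    onComponent-functional (s , ps , qs) (t , pt , qt) =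
      unique C∈ s t (trans ps (sym pt)) (trans qs (sym qt))

    onComponent-injective : ∀ {h h′ k} → OnComponent h k → OnComponent h′ k → h ≡ h′
    onComponent-injective {k = k} (s , ps , qs) (t , pt , qt) =
      trans (sym ps) (trans (p k ∘⟨ section-unique C∈ (objD k) qs qt) pt)

    onComponent⇒deg≡1 : ∀ {h k} → OnComponent h k → deg (q k) ≡ 1
    onComponent⇒deg≡1 {k = k} (t , _ , qt) = section⇒deg≡1 C∈ (objD k) qt

    p≡h∘q⇒onComponent : ∀ {h} k → f ∘ h ≡ g → p k ≡ h ∘ q k → OnComponent h k
    p≡h∘q⇒onComponent {h} k fh pk with j , r@(t , pt , qt) ← onComponent h fh =
      subst (OnComponent h) (unique (objD k) (t ∘ q k) id
        (trans (pullˡ pt) (trans (sym pk) (sym (identityʳ _))))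
        (trans (pullˡ qt) (trans (identityˡ _) (sym (identityʳ _))))) r

    -- Arrows carry no decidable equality in general, but a lift is determined by its component, and
    -- component indices can be compared.
    lift-≟ : ∀ {h h′} → f ∘ h ≡ g → f ∘ h′ ≡ g → Dec (h ≡ h′)
    lift-≟ {h} {h′} fh fh′ with j , r ← onComponent h fh | k , r′ ← onComponent h′ fh′ =
      map′ (λ { refl → onComponent-injective r r′ })
           (λ { refl → onComponent-functional r r′ }) (j Fin.≟ k)

    lifts≤deg : ∀ {m} (e : Fin m → Hom C B) → (∀ k → f ∘ e k ≡ g) → Injective _≡_ _≡_ e →
                m ≤ deg f
    lifts≤deg e fe e-inj = ≤-trans (Fin.injective⇒≤ index-injective) (size≤deg A∈ B∈ C∈ f g K)
      where
      index : Fin _ → Fin size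
      index i = proj₁ (onComponent (e i) (fe i))

      index-injective : Injective _≡_ _≡_ index
      index-injective {i} {j} eq = e-inj (onComponent-injective
        (subst (OnComponent (e i)) eq (proj₂ (onComponent (e i) (fe i))))
        (proj₂ (onComponent (e j) (fe j))))

    -- A component of degree 1 is isomorphic to `C` through `q k`, hence is the graph of the lift
    -- `p k ∘ r`.
    deg≡1⇒lifting : (∀ k → deg (q k) ≡ 1) → Lifting f g
    deg≡1⇒lifting deg1 W∈ w h eq
      with k , t , pt , qt ← factor W∈ h w eq
      with r , rq , qr ← deg≡1⇒iso C∈ (objD k) (q k) (deg1 k)
      = p k ∘ r
      , trans (pullˡ (comm k)) (trans (pullʳ qr) (identityʳ g))
      , (begin
          (p k ∘ r) ∘ w       ≡⟨ (p k ∘ r) ∘⟨ qt ⟨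
          (p k ∘ r) ∘ q k ∘ t ≡⟨ pullʳ (trans (pullˡ rq) (identityˡ t)) ⟩
          p k ∘ t             ≡⟨ pt ⟩
          h                   ∎)

    lifting⇒enumeration : Lifting f g → HasCard 𝒢 (deg f) (λ h → f ∘ h ≡ g)
    lifting⇒enumeration lifts = subst (λ n → HasCard 𝒢 n (λ h → f ∘ h ≡ g))
        (sym (trans degree (finSum-ones size _ (λ k → onComponent⇒deg≡1 (on k)))))
        ( e
        , fe
        , (λ {i} {j} eq → onComponent-functional (subst (λ h → OnComponent h i) eq (on i)) (on j))
        , λ h fh → let k , r = onComponent h fh in k , onComponent-injective (on k) r )
      where
      -- Fullness is applied to the projections of component `k` themselves, making the component a
      -- graph of degree 1.
      lift : ∀ k → Σ[ h ∈ Hom C B ] (f ∘ h ≡ g × h ∘ q k ≡ p k)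
      lift k = lifts (objD k) (q k) (p k) (comm k)

      e : Fin size → Hom C B
      e k = proj₁ (lift k)

      fe : ∀ k → f ∘ e k ≡ g
      fe k = proj₁ (proj₂ (lift k))

      on : ∀ k → OnComponent (e k) k
      on k = p≡h∘q⇒onComponent k (fe k) (sym (proj₂ (proj₂ (lift k))))

    -- Over `W` the arrow `a` meets component `k`. Fullness of `v` extends `p k ∘ x` to a lift `h`
    -- on all of `V`; the pair of `h` and `a` lies on one component, which must be `k` because they
    -- meet over `W`.
    component-below : ∀ k {V} → inD V → (v : Hom V A) → Lifting f v →
                      Σ[ a ∈ Hom V C ] g ∘ a ≡ v → Σ[ a ∈ Hom V (obj k) ] (g ∘ q k) ∘ a ≡ v
    component-below k V∈ v lifts (a , ga)
      with W , W∈ , x , y , qx ← amalgamate C∈ (objD k) V∈ (q k) a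
      with h , fh , hy ← lifts W∈ y (p k ∘ x)
             (trans (pullˡ (comm k)) (trans (pullʳ qx) (pullˡ ga)))
      with j , t , pt , qt ← factor V∈ h a (trans fh (sym ga))
      with refl ← unique W∈ (t ∘ y) x (trans (pullˡ pt) hy) (trans (pullˡ qt) (sym qx))
      = t , trans (pullʳ qt) ga

  cons-injective : ∀ {m} {A B : Obj} {h : Hom A B} {e : Fin m → Hom A B} →
                   (∀ k → h ≢ e k) → Injective _≡_ _≡_ e → Injective _≡_ _≡_ (h ∷ e)
  cons-injective h∉e e-inj {zero}  {zero}  _  = refl
  cons-injective h∉e e-inj {zero}  {suc j} eq = contradiction eq (h∉e j)
  cons-injective h∉e e-inj {suc i} {zero}  eq = contradiction (sym eq) (h∉e i)
  cons-injective h∉e e-inj {suc i} {suc j} eq = cong suc (e-inj eq)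

  -- Since `w` is epic, the `e k ∘ w` are `deg f` distinct lifts of `g ∘ w`; an `h` outside them
  -- would be one lift too many.
  injection⇒lifting : ∀ {A B C} → inD A → inD B → inD C → (f : Hom B A) (g : Hom C A)
    (e : Fin (deg f) → Hom C B) → (∀ k → f ∘ e k ≡ g) → Injective _≡_ _≡_ e → Lifting f g
  injection⇒lifting A∈ B∈ C∈ f g e fe e-inj W∈ w h fh
    with Fin.any? (λ k → lift-≟ A∈ B∈ W∈ f (g ∘ w) {e k ∘ w} {h} (pullˡ (fe k)) fh)
  ... | yes (k , ew) = e k , fe k , ew
  ... | no h∉ = contradiction
    (lifts≤deg A∈ B∈ W∈ f (g ∘ w) (h ∷ λ k → e k ∘ w)
      (λ { zero → fh ; (suc k) → pullˡ (fe k) })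
      (cons-injective (λ k eq → h∉ (k , sym eq))
        (λ eq → e-inj (epic W∈ C∈ B∈ w _ _ eq))))
    1+n≰n

  -- Least full arrows and self-lifting.

  module _ {A B} (A∈ : inD A) (B∈ : inD B) (f : Hom B A) where

    LowerBound : ∀ {C} → Hom C A → Set (o ⊔ ℓ)
    LowerBound {C} g = ∀ {V} → inD V → (v : Hom V A) → Lifting f v → Σ[ a ∈ Hom V C ] g ∘ a ≡ v

    -- The recursion is on r, the number of lifts that could still appear.
    enlarge : ∀ r {m C} → r + m ≡ suc (deg f) → inD C → (g : Hom C A) → LowerBound g →
      (e : Fin m → Hom C B) → (∀ k → f ∘ e k ≡ g) → Injective _≡_ _≡_ e →
      Σ[ C ∈ Obj ] inD C × (Σ[ g ∈ Hom C A ] Lifting f g × LowerBound g)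
    enlarge zero refl C∈ g _ e fe e-inj =
      contradiction (lifts≤deg A∈ B∈ C∈ f g e fe e-inj) 1+n≰n
    enlarge (suc r) {m} r+m C∈ g below e fe e-inj
      with Fin.any? (λ k → ¬? (deg (Components.q (components A∈ B∈ C∈ f g) k) ≟ 1))
    ... | no all1 = _ , C∈ , g
          , deg≡1⇒lifting A∈ B∈ C∈ f g (λ k → decidable-stable (_ ≟ 1) (λ ≢1 → all1 (k , ≢1)))
          , below
    -- The old lifts stay distinct because `q k` is epic. The lift `p k` is new: were it some
    -- `e i ∘ q k`, the component would be the graph of `e i` and have degree 1.
    ... | yes (k , ≢1) = enlarge r (trans (+-suc r m) r+m) (objD k) (g ∘ q k)
          (λ V∈ v lifts → component-below A∈ B∈ C∈ f g k V∈ v lifts (below V∈ v lifts))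
          (p k ∷ λ i → e i ∘ q k)
          (λ { zero → comm k ; (suc i) → pullˡ (fe i) })
          (cons-injective
            (λ i eq → ≢1 (onComponent⇒deg≡1 A∈ B∈ C∈ f g
                            (p≡h∘q⇒onComponent A∈ B∈ C∈ f g k (fe i) eq)))
            (λ eq → e-inj (epic (objD k) C∈ B∈ (q k) _ _ eq)))
      where open Components (components A∈ B∈ C∈ f g)

    leastLifting : Σ[ C ∈ Obj ] inD C × (Σ[ g ∈ Hom C A ] Lifting f g × LowerBound g)
    leastLifting = enlarge (suc (deg f)) (+-identityʳ _) A∈ id (λ _ v _ → v , identityˡ v)
      (λ ()) (λ ()) (λ { {()} })

    -- Fullness of `g` extends `x ∘ z` to `x₁` on `C`, and then `x₁ ∘ w` along `h` to `x₂`. The two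
    -- glue on the pushout, and epicness removes the auxiliary `i` and `z`.
    pushout-lifting : ∀ {C W P} → inD C → inD W → {g : Hom C A} → Lifting f g →
      {w h : Hom W C} → g ∘ w ≡ g ∘ h → {i j : Hom C P} → IsPushoutD w h i j →
      {π : Hom P A} → π ∘ i ≡ g → Lifting f π
    pushout-lifting C∈ W∈ lifts {w} {h} gw {i} {j} (P∈ , _ , universal) {π} πi V∈ v x fx
      with T , T∈ , y , z , iy ← amalgamate P∈ C∈ V∈ i v
      with x₁ , fx₁ , x₁y ← lifts T∈ y (x ∘ z)
             (trans (pullˡ fx) (trans (pullʳ (sym iy)) (pullˡ πi)))
      with x₂ , _ , x₂h ← lifts W∈ h (x₁ ∘ w) (trans (pullˡ fx₁) gw)
      with u , ui , _ , _ ← universal B∈ x₁ x₂ (sym x₂h)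
      = u
      , epic C∈ P∈ A∈ i (f ∘ u) π (trans (pullʳ ui) (trans fx₁ (sym πi)))
      , epic T∈ V∈ B∈ z (u ∘ v) x (begin
          (u ∘ v) ∘ z ≡⟨ pullʳ (sym iy) ⟩
          u ∘ i ∘ y   ≡⟨ pullˡ ui ⟩
          x₁ ∘ y      ≡⟨ x₁y ⟩
          x ∘ z       ∎)

    least⇒self-lifting : ∀ {C} → inD C → (g : Hom C A) → Lifting f g → LowerBound g → Lifting g g
    least⇒self-lifting C∈ g lifts below W∈ w h gh =
      let P , i , j , P∈ , iw , universal = pushout W∈ C∈ C∈ w h
          π , πi , πj , _ = universal A∈ g g (sym gh)
          -- `π` is full, so it factors through `g`, which makes `j` invertible; `i ∘ w ≡ j ∘ h`
          -- then shows that `j⁻¹ ∘ i` carries `w` to `h`.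
          c , gc = below P∈ π (pushout-lifting C∈ W∈ lifts (sym gh) (P∈ , iw , universal) πi)
          j⁻¹ , j⁻¹j , jj⁻¹ = retract⇒iso A∈ P∈ C∈ g π c j gc πj
      in j⁻¹ ∘ i
       , trans (pullˡ (factor-iso πj jj⁻¹)) πi
       , trans (pullʳ iw) (trans (pullˡ j⁻¹j) (identityˡ h))

    -- Over `T` the lift `h` becomes `a ∘ y`. Self-lifting extends `y` to an endomorphism `σ` over
    -- `A`, and `a ∘ σ` is the lift sought.
    self-lifting⇒lifting : ∀ {C} → inD C → (g : Hom C A) → Lifting g g →
      (a : Hom C B) → f ∘ a ≡ g → Lifting f g
    self-lifting⇒lifting C∈ g lifts a fa W∈ w h fh
      with T , T∈ , y , z , ay ← amalgamate B∈ C∈ W∈ a h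
      with σ , gσ , σwz ← lifts T∈ (w ∘ z) y (begin
             g ∘ y       ≡⟨ fa ⟩∘ y ⟨
             (f ∘ a) ∘ y ≡⟨ pullʳ ay ⟩
             f ∘ h ∘ z   ≡⟨ pullˡ fh ⟩
             (g ∘ w) ∘ z ≡⟨ assoc z w g ⟩
             g ∘ w ∘ z   ∎)
      = a ∘ σ
      , trans (pullˡ fa) gσ
      , epic T∈ W∈ B∈ z ((a ∘ σ) ∘ w) h (begin
          ((a ∘ σ) ∘ w) ∘ z ≡⟨ assoc z w (a ∘ σ) ⟩
          (a ∘ σ) ∘ w ∘ z   ≡⟨ pullʳ σwz ⟩
          a ∘ y             ≡⟨ ay ⟩
          h ∘ z             ∎)

  -- Covers, minimality and Galois closures.

  ⊑-trans : ∀ {X} (f g h : Cover 𝒢 X) → _⊑_ 𝒢 f g → _⊑_ 𝒢 g h → _⊑_ 𝒢 f h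
  ⊑-trans f g h (a , fa) (b , gb) = a ∘ b , trans (pullˡ fa) gb

  least⇒minimal : ∀ {X} (P : Cover 𝒢 X → Set ℓ) g → Least 𝒢 P g → Minimal 𝒢 P g
  least⇒minimal P g (Pg , least) = Pg , λ h Ph _ → least h Ph

  -- A least `g₀` lies below a minimal `g`, so minimality puts `g` below `g₀` and thus below
  -- everything with `P`.
  minimal⇔least : ∀ {X} (P : Cover 𝒢 X → Set ℓ) g₀ → Least 𝒢 P g₀ →
                  ∀ g → Minimal 𝒢 P g ⇔ Least 𝒢 P g
  minimal⇔least P g₀ (Pg₀ , least) g = mk⇔
    (λ (Pg , minimal) → Pg , λ h Ph →
      ⊑-trans g g₀ h (minimal g₀ Pg₀ (least g Pg)) (least h Ph))
    (least⇒minimal P g)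

  module _ {X} (X∈ : inD X) where

    Full⇒lifting : (f g : Cover 𝒢 X) → FullHom 𝒢 f g → Lifting (arr f) (arr g)
    Full⇒lifting f g (e , fe , e-inj , _) =
      injection⇒lifting X∈ (domD f) (domD g) (arr f) (arr g) e fe e-inj

    lifting⇒Full : (f g : Cover 𝒢 X) → Lifting (arr f) (arr g) → FullHom 𝒢 f g
    lifting⇒Full f g = lifting⇒enumeration X∈ (domD f) (domD g) (arr f) (arr g)

    Galois⇒self-lifting : (g : Cover 𝒢 X) → IsGalois 𝒢 g → Lifting (arr g) (arr g)
    Galois⇒self-lifting g (e , aut , e-inj , _) =
      injection⇒lifting X∈ (domD g) (domD g) (arr g) (arr g) e (λ k → proj₁ (aut k)) e-inj

    -- Cancelling `deg (arr g)` leaves `deg h ≡ 1`. Hence counting automorphisms is counting all of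
    -- Hom(g, g).
    endo⇒iso : (g : Cover 𝒢 X) → ∀ {h} → HomC 𝒢 g g h → IsIso h
    endo⇒iso g {h} gh = deg≡1⇒iso (domD g) (domD g) h
      (m*n≡m⇒n≡1 (degPos X∈ (arr g)) (trans (sym (degMul (domD g) X∈ h (arr g))) (cong deg gh)))

    self-lifting⇒Galois : (g : Cover 𝒢 X) → Lifting (arr g) (arr g) → IsGalois 𝒢 g
    self-lifting⇒Galois g lifts =
      let e , ge , e-inj , onto = lifting⇒Full g g lifts
      in e , (λ k → ge k , endo⇒iso g (ge k)) , e-inj , λ h aut → onto h (proj₁ aut)

    GaloisOver⇒Full : (f g : Cover 𝒢 X) → GaloisOver 𝒢 f g → FullHom 𝒢 f g
    GaloisOver⇒Full f g (galois , a , fa) = lifting⇒Full f g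
      (self-lifting⇒lifting X∈ (domD f) (arr f) (domD g) (arr g)
        (Galois⇒self-lifting g galois) a fa)

    Full⇒⊑ : (f g : Cover 𝒢 X) → FullHom 𝒢 f g → _⊑_ 𝒢 f g
    Full⇒⊑ f g (e , fe , _) with deg (arr f) | degPos X∈ (arr f)
    ... | suc _ | _ = e zero , fe zero

    leastFull⇒GaloisOver : (f g : Cover 𝒢 X) → Least 𝒢 (FullHom 𝒢 f) g → GaloisOver 𝒢 f g
    leastFull⇒GaloisOver f g (full , least) =
      self-lifting⇒Galois g (least⇒self-lifting X∈ (domD f) (arr f) (domD g) (arr g)
        (Full⇒lifting f g full)
        (λ V∈ v lifts → least (cover _ V∈ v) (lifting⇒Full f (cover _ V∈ v) lifts)))
      , Full⇒⊑ f g full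

    leastFull : (f : Cover 𝒢 X) → Σ[ g ∈ Cover 𝒢 X ] Least 𝒢 (FullHom 𝒢 f) g
    leastFull f =
      let C , C∈ , g , lifts , below = leastLifting X∈ (domD f) (arr f)
      in cover C C∈ g
       , lifting⇒Full f (cover C C∈ g) lifts
       , λ h full → below (domD h) (arr h) (Full⇒lifting f h full)

    leastFull⇒leastGaloisOver : (f g : Cover 𝒢 X) →
      Least 𝒢 (FullHom 𝒢 f) g → Least 𝒢 (GaloisOver 𝒢 f) g
    leastFull⇒leastGaloisOver f g least@(_ , below) =
      leastFull⇒GaloisOver f g least , λ h over → below h (GaloisOver⇒Full f h over)

    -- The least full `g₀` is itself Galois above `f`, so `g` lies below it.
    leastGaloisOver⇒leastFull : (f g : Cover 𝒢 X) →
      Least 𝒢 (GaloisOver 𝒢 f) g → Least 𝒢 (FullHom 𝒢 f) g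
    leastGaloisOver⇒leastFull f g (over , below) =
      let g₀ , least₀ = leastFull f
      in GaloisOver⇒Full f g over
       , λ h full → ⊑-trans g g₀ h
           (below g₀ (leastFull⇒GaloisOver f g₀ least₀)) (proj₂ least₀ h full)

theorem4p7 : ∀ {o ℓ : Level} (𝒢 : GaloisCat o ℓ) {X : GaloisCat.Obj 𝒢} →
    GaloisCat.inD 𝒢 X → (f : Cover 𝒢 X) →
    (Σ[ g ∈ Cover 𝒢 X ] IsGaloisClosure 𝒢 f g)
    × (∀ (g g' : Cover 𝒢 X) → IsGaloisClosure 𝒢 f g → IsGaloisClosure 𝒢 f g' →
    CoverIso 𝒢 g g')
    × (∀ (g : Cover 𝒢 X) →
    (IsGaloisClosure 𝒢 f g ⇔ Least 𝒢 (GaloisOver 𝒢 f) g)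
    × (IsGaloisClosure 𝒢 f g ⇔ Least 𝒢 (FullHom 𝒢 f) g)
    × (IsGaloisClosure 𝒢 f g ⇔ Minimal 𝒢 (FullHom 𝒢 f) g))
theorem4p7 𝒢 {X} X∈ f =
    (g₀ , least⇒minimal 𝒢 (GaloisOver 𝒢 f) g₀ galois₀)
  , (λ g g′ closure closure′ →
      let galois  = to (closure⇔least g) closure
          galois′ = to (closure⇔least g′) closure′
      in proj₂ galois g′ (proj₁ galois′) , proj₂ galois′ g (proj₁ galois))
  , λ g → closure⇔least g , closure⇔leastFull g
        , mk⇔ (λ c → from (minimalFull⇔least g) (to (closure⇔leastFull g) c))
              (λ m → from (closure⇔leastFull g) (to (minimalFull⇔least g) m))
  where
  open Equivalence using (to; from)

  g₀ : Cover 𝒢 X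
  g₀ = proj₁ (leastFull 𝒢 X∈ f)

  full₀ : Least 𝒢 (FullHom 𝒢 f) g₀
  full₀ = proj₂ (leastFull 𝒢 X∈ f)

  galois₀ : Least 𝒢 (GaloisOver 𝒢 f) g₀
  galois₀ = leastFull⇒leastGaloisOver 𝒢 X∈ f g₀ full₀

  closure⇔least : ∀ g → IsGaloisClosure 𝒢 f g ⇔ Least 𝒢 (GaloisOver 𝒢 f) g
  closure⇔least = minimal⇔least 𝒢 (GaloisOver 𝒢 f) g₀ galois₀

  minimalFull⇔least : ∀ g → Minimal 𝒢 (FullHom 𝒢 f) g ⇔ Least 𝒢 (FullHom 𝒢 f) g
  minimalFull⇔least = minimal⇔least 𝒢 (FullHom 𝒢 f) g₀ full₀

  closure⇔leastFull : ∀ g → IsGaloisClosure 𝒢 f g ⇔ Least 𝒢 (FullHom 𝒢 f) g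
  closure⇔leastFull g = mk⇔
    (λ c → leastGaloisOver⇒leastFull 𝒢 X∈ f g (to (closure⇔least g) c))
    (λ l → from (closure⇔least g) (leastFull⇒leastGaloisOver 𝒢 X∈ f g l))
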